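{- For every $n\ge 1$ and every inert triplet $(H,G,\mathbf c)$ (with $H$ and $G$ on $n$ vertices), the value $\mathbf c(H')$ has the same residue modulo $4$ for every copy $H'$ of $H$ in $G$; that is, $\mathbf c(H')\equiv\mathbf c(H'')\pmod 4$ for any two copies $H',H''$ of $H$ in $G$.
   Context: For a $2$-edge-colouring $\mathbf c:E(G)\to\{ -1,1\}$ of a graph $G$ and a subgraph $G'\subseteq G$, write $\mathbf c(G')=\sum_{e\in E(G')}\mathbf c(e)$. Let $G$ be a graph on $n$ vertices (a spanning subgraph of $K_n$). A colouring $\mathbf c:E(G)\to\{ -1,1\}$ is called bipartite if there is a partition $(V_1,V_2)$ of the vertex set of $G$ such that either $\mathbf c^{ -1}(1)$ or $\mathbf c^{ -1}(-1)$ is equal to the edge set of $G[V_1]\cup G[V_2]$. For an $n$-vertex graph $H$, an $n$-vertex graph $G$ (a spanning subgraph of $K_n$) and a colouring $\mathbf c:E(G)\to\{ -1,1\}$, the triplet $(H,G,\mathbf c)$ is inert if all degrees in $H$ have the same parity and the colouring $\mathbf c$ is bipartite. A copy of $H$ in $G$ is a subgraph of $G$ isomorphic to $H$. -}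

module Defs where

open import Data.Bool.Base using (Bool; true; false; T)
open import Data.Bool.Properties using (T?)
open import Data.Fin.Base using (Fin)
open import Data.Fin.Properties using (_<?_)
open import Data.Fin.Subset using (Subset; _∈_; _∪_; _∩_; ⊤; ⊥; ∣_∣)
open import Data.Integer.Base using (ℤ; 0ℤ; _-_; +_; _◃_)
open import Data.Integer.Divisibility.Signed using (_∣_)
open import Data.Integer.Properties using (+-0-commutativeMonoid)
open import Data.Nat.Base using (ℕ; parity)
open import Data.Product.Base using (∃; ∃₂; _×_; _,_; proj₁)
open import Data.Sign.Base using (Sign)
open import Data.Sum.Base using (_⊎_)
open import Data.Vec.Base using (tabulate)
open import Function.Bundles using (_⇔_; _↔_; Inverse)
open import Relation.Binary.PropositionalEquality.Core using (_≡_; refl)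
open import Relation.Nullary.Decidable.Core using (yes; no; _×-dec_)
open import Algebra.Properties.CommutativeMonoid.Sum +-0-commutativeMonoid using (sum)

record Graph (V : Set) : Set where
  field
    adj        : V → V → Bool
    adj-sym    : ∀ u v → adj u v ≡ adj v u
    adj-irrefl : ∀ v → adj v v ≡ false

open Graph public

record _≅_ {V W : Set} (G : Graph V) (H : Graph W) : Set where
  field
    bijection    : V ↔ W
    adj-preserve : ∀ u v → adj G u v ≡ adj H (Inverse.to bijection u) (Inverse.to bijection v)

open _≅_ public

degree : ∀ {n} → Graph (Fin n) → Fin n → ℕ
degree G v = ∣ tabulate (adj G v) ∣

-- A subgraph need not be spanning: it has its own vertex set.
record Subgraph {n : ℕ} (G : Graph (Fin n)) : Set where
  field
    vertices  : Subset n
    sadj      : Fin n → Fin n → Bool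
    sadj-sym  : ∀ u v → sadj u v ≡ sadj v u
    sadj-ends : ∀ u v → T (sadj u v) → u ∈ vertices × v ∈ vertices
    sadj⇒adj  : ∀ u v → T (sadj u v) → T (adj G u v)

open Subgraph public

-- Colourings take values in Sign; s ◃ 1 is the corresponding integer ±1.
-- An edge is presented by either of its two orientations, hence colour-sym.
record Colouring {n : ℕ} (G : Graph (Fin n)) : Set where
  field
    colour     : ∀ u v → T (adj G u v) → Sign
    colour-sym : ∀ u v (e : T (adj G u v)) (e′ : T (adj G v u)) →
                 colour u v e ≡ colour v u e′

open Colouring public

module _ {n : ℕ} {G : Graph (Fin n)} where

  private
    no-loop : ∀ {b b′} → (T b → T b′) → b′ ≡ false → b ≡ false
    no-loop {false}        _ _  = refl
    no-loop {true} {false} f _  with () ← f _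

  toGraph : (S : Subgraph G) → Graph (∃ λ v → v ∈ vertices S)
  toGraph S = record
    { adj        = λ u v → sadj S (proj₁ u) (proj₁ v)
    ; adj-sym    = λ u v → sadj-sym S (proj₁ u) (proj₁ v)
    ; adj-irrefl = λ v → no-loop (sadj⇒adj S (proj₁ v) (proj₁ v)) (adj-irrefl G (proj₁ v))
    }

  -- Each edge is counted once, through its orientation with u < v.
  edgeValue : Colouring G → Subgraph G → Fin n → Fin n → ℤ
  edgeValue c S u v with u <? v ×-dec T? (sadj S u v)
  ... | yes (_ , e) = colour c u v (sadj⇒adj S u v e) ◃ 1
  ... | no  _       = 0ℤ

  total : Colouring G → Subgraph G → ℤ
  total c S = sum λ u → sum λ v → edgeValue c S u v

  -- c⁻¹(s) = E(G[V₁] ∪ G[V₂])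
  ColourClassIs : Colouring G → Sign → Subset n → Subset n → Set
  ColourClassIs c s V₁ V₂ = ∀ u v (e : T (adj G u v)) →
    colour c u v e ≡ s ⇔ ((u ∈ V₁ × v ∈ V₁) ⊎ (u ∈ V₂ × v ∈ V₂))

  -- Parts of the partition are allowed to be empty.
  IsBipartite : Colouring G → Set
  IsBipartite c = ∃₂ λ (V₁ V₂ : Subset n) →
    (V₁ ∪ V₂ ≡ ⊤ × V₁ ∩ V₂ ≡ ⊥) ×
    (ColourClassIs c Sign.+ V₁ V₂ ⊎ ColourClassIs c Sign.- V₁ V₂)

record Inert {n : ℕ} (H G : Graph (Fin n)) (c : Colouring G) : Set where
  field
    same-parity : ∀ u v → parity (degree H u) ≡ parity (degree H v)
    bipartite   : IsBipartite c

record Copy {n : ℕ} (H G : Graph (Fin n)) : Set where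
  field
    subgraph : Subgraph G
    iso      : H ≅ toGraph subgraph

open Copy public

infix 4 _≡_[mod_]

_≡_[mod_] : ℤ → ℤ → ℕ → Set
x ≡ y [mod m ] = + m ∣ x - y

{-# OPTIONS --safe #-}

-- Let bᵥ indicate v ∈ V₂.  Up to a global sign σ, an edge uv has colour
-- (1 − 2bᵤ)(1 − 2bᵥ), so a copy S has total σ(e(S) − 2 Σᵥ bᵥ deg_S(v)) modulo 4.
-- A copy of H spans G, so e(S) = e(H) and the degrees in S are those of H.
-- These all have the same parity, so Σᵥ bᵥ deg_S(v) modulo 2 is independent of S.
module Submission where

open import Defs
open import Data.Nat.Base using (ℕ; _≥_)
open import Data.Fin.Base using (Fin)

open import Data.Bool.Base using (Bool; true; false; T)
open import Data.Bool.Properties using (T?)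
open import Data.Fin.Base using (zero; suc; punchOut)
open import Data.Fin.Permutation using (Permutation; permutation; _⟨$⟩ʳ_; _⟨$⟩ˡ_; inverseʳ)
open import Data.Fin.Properties using (_<?_; <-cmp; punchOut-injective; injective⇒≤)
open import Data.Fin.Subset using (Subset; _∈_; _∉_; ∣_∣)
open import Data.Fin.Subset.Properties
  using (_∈?_; ∈⊤; ∉⊥; x∈p∩q⁺; x∈p∪q⁻)
open import Data.Integer.Base using (ℤ; +_; 0ℤ; 1ℤ; _+_; _*_; _-_; -_; _◃_)
open import Data.Integer.Divisibility.Signed
  using (_∣_; divides; ∣-refl; ∣m∣n⇒∣m+n; ∣n⇒∣m*n)
open import Data.Integer.Properties
  using (+-0-commutativeMonoid; +-*-semiring; *-zeroʳ; *-identityʳ; +-identityˡ; +-identityʳ;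
         *-cancelˡ-≡)
open import Data.Integer.Tactic.RingSolver using (solve-∀)
open import Data.Nat.Base using (zero; suc; parity)
open import Data.Nat.Properties using (1+n≰n)
open import Data.Product.Base using (∃; _,_; proj₁; proj₂)
open import Data.Sign.Base as Sign using (Sign; opposite)
open import Data.Sum.Base using (inj₁; inj₂; [_,_]′)
open import Data.Vec.Base using (tabulate)
open import Data.Vec.Properties.WithK using ([]=-irrelevant)
open import Function.Base using (_∘_)
open import Function.Bundles using (_↔_; Inverse; Equivalence)
open import Relation.Binary.Definitions using (tri<; tri≈; tri>)
open import Relation.Binary.PropositionalEquality
  using (_≡_; _≢_; refl; sym; trans; cong; cong₂; subst; module ≡-Reasoning)
open import Relation.Nullary.Decidable using (does; yes; no; dec-true; dec-false; _×-dec_)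
open import Relation.Nullary.Negation using (contradiction)

open import Algebra.Properties.CommutativeMonoid.Sum +-0-commutativeMonoid
  using (sum; sum-cong-≗; sum-permute; ∑-distrib-+; ∑-comm)
open import Algebra.Properties.Semiring.Sum +-*-semiring using (*-distribˡ-sum)

open ≡-Reasoning

-- Finite sums of integers, and parity.

⟦_⟧ : Bool → ℤ
⟦ true  ⟧ = 1ℤ
⟦ false ⟧ = 0ℤ

∑∑ : ∀ {n} → (Fin n → Fin n → ℤ) → ℤ
∑∑ f = sum λ u → sum λ v → f u v

∑∑-cong : ∀ {n} {f g : Fin n → Fin n → ℤ} → (∀ u v → f u v ≡ g u v) → ∑∑ f ≡ ∑∑ g
∑∑-cong f≗g = sum-cong-≗ (λ u → sum-cong-≗ (f≗g u))

∑∑-distrib-+ : ∀ {n} (f g : Fin n → Fin n → ℤ) →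
               ∑∑ (λ u v → f u v + g u v) ≡ ∑∑ f + ∑∑ g
∑∑-distrib-+ f g =
  trans (sum-cong-≗ (λ u → ∑-distrib-+ (f u) (g u))) (∑-distrib-+ (λ u → sum (f u)) (λ u → sum (g u)))

*-distribˡ-∑∑ : ∀ {n} x (f : Fin n → Fin n → ℤ) → ∑∑ (λ u v → x * f u v) ≡ x * ∑∑ f
*-distribˡ-∑∑ x f = sym (trans (*-distribˡ-sum x (λ u → sum (f u)))
  (sum-cong-≗ (λ u → *-distribˡ-sum x (f u))))

∑∑-symmetrise : ∀ {n} (f : Fin n → Fin n → ℤ) →
                ∑∑ (λ u v → f u v + f v u) ≡ ∑∑ f + ∑∑ f
∑∑-symmetrise f =
  trans (∑∑-distrib-+ f (λ u v → f v u)) (cong (_+_ (∑∑ f)) (∑-comm (λ u v → f v u)))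

∣-sum : ∀ {k} {n} (f : Fin n → ℤ) → (∀ i → k ∣ f i) → k ∣ sum f
∣-sum {n = zero}  f k∣f = divides 0ℤ refl
∣-sum {n = suc n} f k∣f = ∣m∣n⇒∣m+n (k∣f zero) (∣-sum (f ∘ suc) (k∣f ∘ suc))

∣tabulate∣ : ∀ {n} (f : Fin n → Bool) → + ∣ tabulate f ∣ ≡ sum (λ i → ⟦ f i ⟧)
∣tabulate∣ {zero}  f = refl
∣tabulate∣ {suc n} f with f zero
... | true  = cong (_+_ 1ℤ) (∣tabulate∣ (f ∘ suc))
... | false = trans (∣tabulate∣ (f ∘ suc)) (sym (+-identityˡ _))

-- `parity` computes through two successors, so removing two at a time from either argument leaves
-- only `0 0` and `1 1`; the mixed cases are refuted by `eq`.
parity≡⇒2∣- : ∀ m n → parity m ≡ parity n → + 2 ∣ + m - + n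
parity≡⇒2∣- (suc (suc m)) n eq =
  subst (+ 2 ∣_) (shift (+ m) (+ n)) (∣m∣n⇒∣m+n (parity≡⇒2∣- m n eq) ∣-refl)
  where
  shift : ∀ x y → (x - y) + + 2 ≡ (+ 2 + x) - y
  shift = solve-∀
parity≡⇒2∣- m (suc (suc n)) eq =
  subst (+ 2 ∣_) (shift (+ m) (+ n)) (∣m∣n⇒∣m+n (parity≡⇒2∣- m n eq) (divides (- 1ℤ) refl))
  where
  shift : ∀ x y → (x - y) + - + 2 ≡ x - (+ 2 + y)
  shift = solve-∀
parity≡⇒2∣- 0 0 eq = divides 0ℤ refl
parity≡⇒2∣- 1 1 eq = divides 0ℤ refl

-- Bijections from `Fin n` onto a vertex subset.

↔⇒full : ∀ {n} {V : Subset n} → Fin n ↔ (∃ λ v → v ∈ V) → ∀ v → v ∈ V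
↔⇒full {suc n} {V} β v with v ∈? V
... | yes v∈V = v∈V
-- Pigeonhole: if `v` is missed, punching it out of the image injects `Fin (suc n)` into `Fin n`.
... | no  v∉V = contradiction (injective⇒≤ {f = λ i → punchOut (avoids i)}
                  (injective ∘ punchOut-injective (avoids _) (avoids _))) 1+n≰n
  where
  open Inverse β

  avoids : ∀ i → v ≢ proj₁ (to i)
  avoids i eq = v∉V (subst (_∈ V) (sym eq) (proj₂ (to i)))

  injective : ∀ {i j} → proj₁ (to i) ≡ proj₁ (to j) → i ≡ j
  injective {i} {j} eq = trans (sym (strictlyInverseʳ i))
    (trans (cong from (∃-≡ (to i) (to j) eq)) (strictlyInverseʳ j))
    where
    -- Membership proofs are unique, so a point of the subset is determined by its vertex.
    ∃-≡ : (x y : ∃ λ w → w ∈ V) → proj₁ x ≡ proj₁ y → x ≡ y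
    ∃-≡ (w , p) (_ , q) refl = cong (w ,_) ([]=-irrelevant p q)

-- Since `V` is full, dropping the membership proofs keeps the map bijective. A permutation of
-- `Fin n` is the form that `sum-permute` needs.
↔⇒permutation : ∀ {n} {V : Subset n} → Fin n ↔ (∃ λ v → v ∈ V) → Permutation n n
↔⇒permutation β = permutation (proj₁ ∘ to) (λ v → from (v , ↔⇒full β v))
  (λ v → cong proj₁ (strictlyInverseˡ (v , ↔⇒full β v)))
  (λ i → trans (cong (λ p → from (proj₁ (to i) , p)) ([]=-irrelevant _ _)) (strictlyInverseʳ i))
  where open Inverse β

-- Degree sums in a subgraph.

module _ {n : ℕ} {G : Graph (Fin n)} where

  subdegree : Subgraph G → Fin n → ℤ
  subdegree S u = sum λ v → ⟦ sadj S u v ⟧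

  -- The strictly upper triangle of the adjacency matrix: each edge counts once, at the orientation
  -- that `edgeValue` selects.
  upper : Subgraph G → Fin n → Fin n → ℤ
  upper S u v = ⟦ does (u <? v ×-dec T? (sadj S u v)) ⟧

  sadj-irrefl : (S : Subgraph G) → ∀ v → sadj S v v ≡ false
  sadj-irrefl S v with sadj S v v | sadj⇒adj S v v
  ... | false | _ = refl
  ... | true  | f with () ← subst T (adj-irrefl G v) (f _)

  -- By trichotomy exactly one orientation survives off the diagonal; on it everything vanishes, as
  -- there are no loops.
  upper-symmetrise : (S : Subgraph G) → ∀ u v → upper S u v + upper S v u ≡ ⟦ sadj S u v ⟧
  upper-symmetrise S u v rewrite sadj-sym S v u with <-cmp u v
  ... | tri< u<v _ v≮u rewrite dec-true (u <? v) u<v | dec-false (v <? u) v≮u =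
        +-identityʳ _
  ... | tri≈ u≮v refl _ rewrite dec-false (u <? u) u≮v | sadj-irrefl S u = refl
  ... | tri> u≮v _ v<u rewrite dec-false (u <? v) u≮v | dec-true (v <? u) v<u =
        +-identityˡ _

  edges : Subgraph G → ℤ
  edges S = ∑∑ (upper S)

  handshake : (S : Subgraph G) → + 2 * edges S ≡ sum (subdegree S)
  handshake S = begin
    + 2 * edges S                             ≡⟨ double (edges S) ⟩
    edges S + edges S                         ≡⟨ ∑∑-symmetrise (upper S) ⟨
    ∑∑ (λ u v → upper S u v + upper S v u)    ≡⟨ ∑∑-cong (upper-symmetrise S) ⟩
    sum (subdegree S)                         ∎
    where
    double : ∀ x → + 2 * x ≡ x + x
    double = solve-∀

  -- Double counting: an edge uv adds `b u` at u and `b v` at v. Exchanging the summation order in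
  -- the `b v` half moves all weights to the first index, where the two triangles add up to the full
  -- adjacency matrix.
  weighted-handshake : (S : Subgraph G) (b : Fin n → ℤ) →
    ∑∑ (λ u v → upper S u v * (b u + b v)) ≡ sum (λ u → b u * subdegree S u)
  weighted-handshake S b = begin
    ∑∑ (λ u v → A u v * (b u + b v))              ≡⟨ ∑∑-cong (λ u v → expand (A u v) (b u) (b v)) ⟩
    ∑∑ (λ u v → b u * A u v + b v * A u v)        ≡⟨ ∑∑-distrib-+ (λ u v → b u * A u v) (λ u v → b v * A u v) ⟩
    ∑∑ (λ u v → b u * A u v) + ∑∑ (λ u v → b v * A u v)
      ≡⟨ cong (_+_ (∑∑ (λ u v → b u * A u v))) (∑-comm (λ u v → b v * A u v)) ⟩
    ∑∑ (λ u v → b u * A u v) + ∑∑ (λ u v → b u * A v u)   ≡⟨ ∑∑-distrib-+ (λ u v → b u * A u v) (λ u v → b u * A v u) ⟨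
    ∑∑ (λ u v → b u * A u v + b u * A v u)
      ≡⟨ ∑∑-cong (λ u v → trans (factor (b u) (A u v) (A v u)) (cong (b u *_) (upper-symmetrise S u v))) ⟩
    ∑∑ (λ u v → b u * ⟦ sadj S u v ⟧)
      ≡⟨ sum-cong-≗ (λ u → *-distribˡ-sum (b u) (λ v → ⟦ sadj S u v ⟧)) ⟨
    sum (λ u → b u * subdegree S u)               ∎
    where
    A = upper S

    expand : ∀ a x y → a * (x + y) ≡ x * a + y * a
    expand = solve-∀

    factor : ∀ x a a′ → x * a + x * a′ ≡ x * (a + a′)
    factor = solve-∀

  -- Totals modulo 4.

  module _ (c : Colouring G) (σ : ℤ) (b : Fin n → ℤ)
    (colour≡ : ∀ u v (e : T (adj G u v)) →
               colour c u v e ◃ 1 ≡ σ * ((1ℤ - + 2 * b u) * (1ℤ - + 2 * b v)))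
    where

    -- The factor `upper` absorbs the case split of `edgeValue`, giving a formula valid at every
    -- pair, so that ring identities apply under the sum.
    edgeValue≡ : (S : Subgraph G) → ∀ u v →
      edgeValue c S u v ≡ σ * ((1ℤ - + 2 * b u) * (1ℤ - + 2 * b v)) * upper S u v
    edgeValue≡ S u v with u <? v ×-dec T? (sadj S u v)
    ... | yes p@(_ , e) = trans (colour≡ u v (sadj⇒adj S u v e)) (trans (sym (*-identityʳ k))
          (cong (λ t → k * ⟦ t ⟧) (sym (dec-true (u <? v ×-dec T? (sadj S u v)) p))))
      where k = σ * ((1ℤ - + 2 * b u) * (1ℤ - + 2 * b v))
    ... | no ¬p = trans (sym (*-zeroʳ k))
          (cong (λ t → k * ⟦ t ⟧) (sym (dec-false (u <? v ×-dec T? (sadj S u v)) ¬p)))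
      where k = σ * ((1ℤ - + 2 * b u) * (1ℤ - + 2 * b v))

    -- Each edge expands as (1 - 2x)(1 - 2y) = 1 - 2(x + y) + 4xy. The middle terms sum to a
    -- weighted degree sum by `weighted-handshake`; the last ones matter only through their factor
    -- 4, so `r` stays existential.
    total≡ : (S : Subgraph G) → ∃ λ r →
      total c S ≡ σ * (edges S - + 2 * sum (λ u → b u * subdegree S u) + + 4 * r)
    total≡ S = ∑∑ R , (begin
      total c S
        ≡⟨ ∑∑-cong (λ u v → trans (edgeValue≡ S u v) (expand σ (b u) (b v) (A u v))) ⟩
      ∑∑ (λ u v → σ * (A u v + (- + 2 * D u v + + 4 * R u v)))
        ≡⟨ *-distribˡ-∑∑ σ (λ u v → A u v + (- + 2 * D u v + + 4 * R u v)) ⟩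
      σ * ∑∑ (λ u v → A u v + (- + 2 * D u v + + 4 * R u v))
        ≡⟨ cong (σ *_) (trans
             (∑∑-distrib-+ A (λ u v → - + 2 * D u v + + 4 * R u v))
             (cong (_+_ (∑∑ A)) (∑∑-distrib-+ (λ u v → - + 2 * D u v) (λ u v → + 4 * R u v)))) ⟩
      σ * (∑∑ A + (∑∑ (λ u v → - + 2 * D u v) + ∑∑ (λ u v → + 4 * R u v)))
        ≡⟨ cong (λ x → σ * (∑∑ A + x)) (cong₂ _+_ (*-distribˡ-∑∑ (- + 2) D) (*-distribˡ-∑∑ (+ 4) R)) ⟩
      σ * (∑∑ A + (- + 2 * ∑∑ D + + 4 * ∑∑ R))
        ≡⟨ cong (λ x → σ * (∑∑ A + (- + 2 * x + + 4 * ∑∑ R))) (weighted-handshake S b) ⟩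
      σ * (∑∑ A + (- + 2 * sum (λ u → b u * subdegree S u) + + 4 * ∑∑ R))
        ≡⟨ regroup σ (∑∑ A) (sum (λ u → b u * subdegree S u)) (∑∑ R) ⟩
      σ * (edges S - + 2 * sum (λ u → b u * subdegree S u) + + 4 * ∑∑ R) ∎)
      where
      A D R : Fin n → Fin n → ℤ
      A     = upper S
      D u v = A u v * (b u + b v)
      R u v = A u v * (b u * b v)

      expand : ∀ s x y a → s * ((1ℤ - + 2 * x) * (1ℤ - + 2 * y)) * a ≡
                           s * (a + (- + 2 * (a * (x + y)) + + 4 * (a * (x * y))))
      expand = solve-∀

      regroup : ∀ s e d r → s * (e + (- + 2 * d + + 4 * r)) ≡ s * (e - + 2 * d + + 4 * r)
      regroup = solve-∀

    total-mod-4 : (S S′ : Subgraph G) → edges S ≡ edges S′ →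
      (∀ u → + 2 ∣ subdegree S′ u - subdegree S u) →
      total c S ≡ total c S′ [mod 4 ]
    total-mod-4 S S′ e≡e′ even
      with total≡ S | total≡ S′ | ∣-sum (λ u → b u * (d′ u - d u)) (λ u → ∣n⇒∣m*n (b u) (even u))
      where
      d  = subdegree S
      d′ = subdegree S′
    -- The weighted degree sums differ by `q * + 2` and enter with coefficient 2, which contributes
    -- 4q; the remainders contribute 4(r - r′).
    ... | r , t≡ | r′ , t′≡ | divides q Δ≡ = divides (σ * (q + r - r′)) (begin
      total c S - total c S′
        ≡⟨ cong₂ _-_ t≡ t′≡ ⟩
      σ * (edges S - + 2 * D S + + 4 * r) - σ * (edges S′ - + 2 * D S′ + + 4 * r′)
        ≡⟨ cong (λ e → σ * (e - + 2 * D S + + 4 * r) - σ * (edges S′ - + 2 * D S′ + + 4 * r′)) e≡e′ ⟩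
      σ * (edges S′ - + 2 * D S + + 4 * r) - σ * (edges S′ - + 2 * D S′ + + 4 * r′)
        ≡⟨ cong (λ x → σ * (edges S′ - + 2 * D S + + 4 * r) - σ * (edges S′ - + 2 * x + + 4 * r′)) D′≡ ⟩
      σ * (edges S′ - + 2 * D S + + 4 * r) - σ * (edges S′ - + 2 * (D S + q * + 2) + + 4 * r′)
        ≡⟨ collect σ (edges S′) (D S) q r r′ ⟩
      σ * (q + r - r′) * + 4 ∎)
      where
      D : Subgraph G → ℤ
      D S = sum λ u → b u * subdegree S u

      split : ∀ x d d′ → x * d′ ≡ x * d + x * (d′ - d)
      split = solve-∀

      D′≡ : D S′ ≡ D S + q * + 2
      D′≡ = trans (sum-cong-≗ (λ u → split (b u) (subdegree S u) (subdegree S′ u)))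
        (trans (∑-distrib-+ (λ u → b u * subdegree S u)
                 (λ u → b u * (subdegree S′ u - subdegree S u))) (cong (_+_ (D S)) Δ≡))

      collect : ∀ s e d q r r′ →
        s * (e - + 2 * d + + 4 * r) - s * (e - + 2 * (d + q * + 2) + + 4 * r′) ≡
        s * (q + r - r′) * + 4
      collect = solve-∀

  -- Bipartite colourings as products of vertex signs.

  bipartite⇒colour≡ : (c : Colouring G) → IsBipartite c →
    ∃ λ (σ : ℤ) → ∃ λ (b : Fin n → ℤ) → ∀ u v (e : T (adj G u v)) →
    colour c u v e ◃ 1 ≡ σ * ((1ℤ - + 2 * b u) * (1ℤ - + 2 * b v))
  bipartite⇒colour≡ c (V₁ , V₂ , (cover , disjoint) , class₊⊎class₋) =
    -- `σ` is the sign of the colour class formed by the edges inside the parts.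
    [ (λ class → Sign.+ ◃ 1 , b , fromClass Sign.+ class)
    , (λ class → Sign.- ◃ 1 , b , fromClass Sign.- class)
    ]′ class₊⊎class₋
    where
    b : Fin n → ℤ
    b v = ⟦ does (v ∈? V₂) ⟧

    -- Only membership in `V₂` is decided below; the partition translates it into membership in
    -- `V₁`.
    ∉V₂⇒∈V₁ : ∀ {v} → v ∉ V₂ → v ∈ V₁
    ∉V₂⇒∈V₁ {v} v∉V₂ with x∈p∪q⁻ V₁ V₂ (subst (v ∈_) (sym cover) ∈⊤)
    ... | inj₁ v∈V₁ = v∈V₁
    ... | inj₂ v∈V₂ = contradiction v∈V₂ v∉V₂

    ∈V₁⇒∉V₂ : ∀ {v} → v ∈ V₁ → v ∉ V₂
    ∈V₁⇒∉V₂ {v} v∈V₁ v∈V₂ = ∉⊥ (subst (v ∈_) disjoint (x∈p∩q⁺ (v∈V₁ , v∈V₂)))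

    ≢⇒opposite : ∀ {s t : Sign} → s ≢ t → s ≡ opposite t
    ≢⇒opposite {Sign.+} {Sign.+} s≢t = contradiction refl s≢t
    ≢⇒opposite {Sign.+} {Sign.-} s≢t = refl
    ≢⇒opposite {Sign.-} {Sign.+} s≢t = refl
    ≢⇒opposite {Sign.-} {Sign.-} s≢t = contradiction refl s≢t

    other : ∀ s → opposite s ◃ 1 ≡ (s ◃ 1) * - 1ℤ
    other Sign.+ = refl
    other Sign.- = refl

    fromClass : ∀ s → ColourClassIs c s V₁ V₂ → ∀ u v (e : T (adj G u v)) →
      colour c u v e ◃ 1 ≡ (s ◃ 1) * ((1ℤ - + 2 * b u) * (1ℤ - + 2 * b v))
    fromClass s class u v e with u ∈? V₂ | v ∈? V₂
    ... | yes u∈ | yes v∈ =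
          trans (cong (_◃ 1) (Equivalence.from (class u v e) (inj₂ (u∈ , v∈)))) (sym (*-identityʳ _))
    ... | no u∉ | no v∉ =
          trans (cong (_◃ 1) (Equivalence.from (class u v e) (inj₁ (∉V₂⇒∈V₁ u∉ , ∉V₂⇒∈V₁ v∉))))
            (sym (*-identityʳ _))
    -- An edge between the parts is outside the class of `s`, so it has the opposite sign, matching
    -- the product -1 of its vertex signs.
    ... | yes u∈ | no v∉ = trans (cong (_◃ 1) (≢⇒opposite mixed)) (other s)
      where
      mixed : colour c u v e ≢ s
      mixed eq with Equivalence.to (class u v e) eq
      ... | inj₁ (u∈V₁ , _) = ∈V₁⇒∉V₂ u∈V₁ u∈
      ... | inj₂ (_ , v∈V₂) = v∉ v∈V₂
    ... | no u∉ | yes v∈ = trans (cong (_◃ 1) (≢⇒opposite mixed)) (other s)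
      where
      mixed : colour c u v e ≢ s
      mixed eq with Equivalence.to (class u v e) eq
      ... | inj₁ (_ , v∈V₁) = ∈V₁⇒∉V₂ v∈V₁ v∈
      ... | inj₂ (u∈V₂ , _) = u∉ u∈V₂

-- Degrees and edge counts of copies.

module _ {n : ℕ} {H G : Graph (Fin n)} where

  placement : Copy H G → Permutation n n
  placement C = ↔⇒permutation (bijection (iso C))

  -- Reindexing the neighbours by the placement makes every summand an instance of `adj-preserve`.
  subdegree-placement : (C : Copy H G) → ∀ i →
    subdegree (subgraph C) (placement C ⟨$⟩ʳ i) ≡ + degree H i
  subdegree-placement C i = begin
    sum (λ v → ⟦ sadj (subgraph C) (π ⟨$⟩ʳ i) v ⟧)           ≡⟨ sum-permute (λ v → ⟦ sadj (subgraph C) (π ⟨$⟩ʳ i) v ⟧) π ⟩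
    sum (λ j → ⟦ sadj (subgraph C) (π ⟨$⟩ʳ i) (π ⟨$⟩ʳ j) ⟧)  ≡⟨ sum-cong-≗ (λ j → cong ⟦_⟧ (adj-preserve (iso C) i j)) ⟨
    sum (λ j → ⟦ adj H i j ⟧)                                ≡⟨ ∣tabulate∣ (adj H i) ⟨
    + degree H i                                             ∎
    where π = placement C

  subdegree≡degree : (C : Copy H G) → ∀ u →
    subdegree (subgraph C) u ≡ + degree H (placement C ⟨$⟩ˡ u)
  subdegree≡degree C u =
    trans (cong (subdegree (subgraph C)) (sym (inverseʳ (placement C))))
      (subdegree-placement C _)

  -- The right side does not depend on `C`, so all copies have equally many edges once 2 is
  -- cancelled.
  2*edges≡∑degree : (C : Copy H G) → + 2 * edges (subgraph C) ≡ sum (λ i → + degree H i)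
  2*edges≡∑degree C = trans (handshake (subgraph C))
    (trans (sum-permute (subdegree (subgraph C)) (placement C)) (sum-cong-≗ (subdegree-placement C)))

proposition1p14 : ∀ (n : ℕ) → n ≥ 1 →
    (H G : Graph (Fin n)) (c : Colouring G) → Inert H G c →
    (H′ H″ : Copy H G) →
    total c (subgraph H′) ≡ total c (subgraph H″) [mod 4 ]
proposition1p14 n _ H G c inert H′ H″ =
  let σ , b , colour≡ = bipartite⇒colour≡ c (Inert.bipartite inert) in
  total-mod-4 c σ b colour≡ (subgraph H′) (subgraph H″)
    (*-cancelˡ-≡ (+ 2) _ _ (trans (2*edges≡∑degree H′) (sym (2*edges≡∑degree H″))))
    -- The two copies may place different vertices of `H` at `u`; `same-parity` makes their degrees
    -- agree modulo 2.
    (λ u → subst (+ 2 ∣_) (sym (cong₂ _-_ (subdegree≡degree H″ u) (subdegree≡degree H′ u)))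
      (parity≡⇒2∣- (degree H (placement H″ ⟨$⟩ˡ u)) (degree H (placement H′ ⟨$⟩ˡ u))
        (Inert.same-parity inert _ _)))
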